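{- Let $\mathbb{P}$ be a $\sigma$-centered forcing notion such that above every element of $\mathbb{P}$ there are two incompatible elements, and suppose $\mathbb{P}$ does not add a Cohen real. Then there exists a non-principal nowhere dense ultrafilter on $\omega$.
   Context: Forcing order convention: $p\leqslant q$ means $q$ is stronger (extends) $p$; "above $p$" means $\geqslant p$. $\mathbb{P}$ is $\sigma$-centered if $\mathbb{P}=\bigcup_{n<\omega}A_n$ where each $A_n$ is directed: for all $p,q\in A_n$ there is $r\in A_n$ with $p\leqslant r$ and $q\leqslant r$. $\mathbb{P}$ adds a Cohen real if there is a $\mathbb{P}$-name $\underline{r}$ for an element of ${}^\omega 2$ such that for every open dense set $\mathcal{D}\subseteq{}^\omega 2$ in the ground model, $\Vdash_{\mathbb{P}}\underline{r}\in\mathcal{D}^*$, where $\mathcal{D}^*$ is the reinterpretation (the open set coded by the same code) of $\mathcal{D}$ in the extension. A filter $D$ on $\omega$ is nowhere dense if for every function $f\colon\omega\to{}^\omega 2$ there is $A\in D$ such that $f(A)$ is nowhere dense in ${}^\omega 2$. -}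

module Defs where

open import Data.Bool.Base using (Bool)
open import Data.Fin.Base using (Fin; toℕ)
open import Data.Nat.Base using (ℕ)
open import Data.Product.Base using (Σ-syntax; ∃; ∃-syntax; _×_; _,_; proj₁; proj₂)
open import Data.Sum.Base using (_⊎_)
open import Data.Vec.Base using (Vec; lookup)
open import Function.Bundles using (Func; _⇔_)
open import Level using (Level; 0ℓ; _⊔_; Lift) renaming (suc to lsuc)
open import Relation.Binary.Bundles using (Preorder; Setoid)
open import Relation.Binary.PropositionalEquality.Core using (_≡_; _≗_)
open import Relation.Nullary.Negation.Core using (¬_)
open import Relation.Unary using (Pred; U; ∅; ∁; _∩_; _⊆_; _≬_; Empty)

-- The set-theoretic axiom of choice.  Setoids stand for sets, so the choice
-- function has to respect their equalities; without that requirement the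
-- statement would be trivial, since ∃ is a Σ-type.

AxiomOfChoice : ∀ a ℓa b ℓb r → Set (lsuc (a ⊔ ℓa ⊔ b ⊔ ℓb ⊔ r))
AxiomOfChoice a ℓa b ℓb r =
  (A : Setoid a ℓa) (B : Setoid b ℓb) →
  let module A = Setoid A
      module B = Setoid B
  in (R : A.Carrier → B.Carrier → Set r) →
     (∀ {x x′ y y′} → x A.≈ x′ → y B.≈ y′ → R x y → R x′ y′) →
     (∀ x → ∃[ y ] R x y) →
     Σ[ f ∈ Func A B ] (∀ x → R x (Func.to f x))

Cantor : Set
Cantor = ℕ → Bool

Seq : Set
Seq = ∃ (Vec Bool)

[_] : Seq → Pred Cantor 0ℓ
[ n , s ] x = (i : Fin n) → x (toℕ i) ≡ lookup s i

Interior : Pred Cantor 0ℓ → Pred Cantor 0ℓ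
Interior X x = ∃[ s ] [ s ] x × [ s ] ⊆ X

Closure : Pred Cantor 0ℓ → Pred Cantor 0ℓ
Closure X x = ∀ s → [ s ] x → [ s ] ≬ X

Open : Pred Cantor 0ℓ → Set
Open X = X ⊆ Interior X

Dense : Pred Cantor 0ℓ → Set
Dense X = ∀ x → Closure X x

NowhereDense : Pred Cantor 0ℓ → Set
NowhereDense X = Empty (Interior (Closure X))

-- Points of ^ω 2 are identified up to pointwise equality.

Image : (ℕ → Cantor) → Pred ℕ 0ℓ → Pred Cantor 0ℓ
Image f A x = ∃[ n ] A n × f n ≗ x

record IsFilter (D : Pred (Pred ℕ 0ℓ) 0ℓ) : Set₁ where
  field
    whole  : D U
    upward : ∀ {A B} → A ⊆ B → D A → D B
    meet   : ∀ {A B} → D A → D B → D (A ∩ B)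
    proper : ¬ D ∅

record IsUltrafilter (D : Pred (Pred ℕ 0ℓ) 0ℓ) : Set₁ where
  field
    isFilter : IsFilter D
    ultra    : ∀ A → D A ⊎ D (∁ A)

Principal : Pred (Pred ℕ 0ℓ) 0ℓ → Set₁
Principal D = ∃[ B ] (∀ A → D A ⇔ B ⊆ A)

IsNowhereDenseFilter : Pred (Pred ℕ 0ℓ) 0ℓ → Set₁
IsNowhereDenseFilter D =
  (f : ℕ → Cantor) → ∃[ A ] D A × NowhereDense (Image f A)

-- p ≲ q means that q is the stronger condition.

module Forcing {c ℓ₁ ℓ₂} (P : Preorder c ℓ₁ ℓ₂) where
  open Preorder P using (Carrier; _≲_)

  Compatible : Carrier → Carrier → Set (c ⊔ ℓ₂)
  Compatible p q = ∃[ r ] p ≲ r × q ≲ r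

  SplitsEverywhere : Set (c ⊔ ℓ₂)
  SplitsEverywhere = ∀ p → ∃[ q ] ∃[ r ] p ≲ q × p ≲ r × ¬ Compatible q r

  Directed : Pred Carrier (c ⊔ ℓ₂) → Set (c ⊔ ℓ₂)
  Directed A = ∀ {p q} → A p → A q → ∃[ r ] A r × p ≲ r × q ≲ r

  SigmaCentered : Set (lsuc (c ⊔ ℓ₂))
  SigmaCentered = Σ[ A ∈ (ℕ → Pred Carrier (c ⊔ ℓ₂)) ]
    (∀ n → Directed (A n)) × (∀ p → ∃[ n ] A n p)

  DenseAbove : Pred Carrier (c ⊔ ℓ₂) → Pred Carrier (c ⊔ ℓ₂)
  DenseAbove Φ p = ∀ q → p ≲ q → ∃[ r ] q ≲ r × Φ r

  -- A sentence φ of the forcing language is given by its forcing relation: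
  -- φ p is p ⊩ φ.  The connectives are the clauses of the usual recursion
  -- defining ⊩, with quantifiers ranging over ground-model sets.

  Sentence : Set (lsuc (c ⊔ ℓ₂))
  Sentence = Pred Carrier (c ⊔ ℓ₂)

  infixr 7 _∧̇_
  infixr 6 _→̇_

  ⌜_⌝ : Set → Sentence
  ⌜ A ⌝ p = Lift (c ⊔ ℓ₂) A

  _∧̇_ : Sentence → Sentence → Sentence
  (φ ∧̇ ψ) p = φ p × ψ p

  _→̇_ : Sentence → Sentence → Sentence
  (φ →̇ ψ) p = ∀ q → p ≲ q → φ q → ψ q

  ∀̇ : {X : Set} → (X → Sentence) → Sentence
  ∀̇ φ p = ∀ x → φ x p

  ∃̇ : {X : Set} → (X → Sentence) → Sentence
  ∃̇ φ = DenseAbove (λ q → ∃[ x ] φ x q)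

  ⊩_ : Sentence → Set (c ⊔ ℓ₂)
  ⊩ φ = ∀ p → φ p

  -- A name for a subset of the ground-model set X: a set of pairs (x̌ , p).

  Name : Set → Set (lsuc (c ⊔ ℓ₂))
  Name X = X → Pred Carrier (c ⊔ ℓ₂)

  infix 8 _∈̇_

  _∈̇_ : {X : Set} → X → Name X → Sentence
  x ∈̇ τ = DenseAbove (λ q → ∃[ p ] τ x p × p ≲ q)

  IsFunction : {X Y : Set} → Name (X × Y) → Sentence
  IsFunction {X} {Y} τ =
    (∀̇ λ x → ∃̇ λ y → (x , y) ∈̇ τ) ∧̇
    (∀̇ λ x → ∀̇ λ y → ∀̇ λ y′ → (x , y) ∈̇ τ ∧̇ (x , y′) ∈̇ τ →̇ ⌜ y ≡ y′ ⌝)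

  _⊏̇_ : Seq → Name (ℕ × Bool) → Sentence
  (n , s) ⊏̇ τ = ∀̇ λ (i : Fin n) → (toℕ i , lookup s i) ∈̇ τ

  -- "τ ∈ D*".  An open set D is coded by the set of all s with [ s ] ⊆ D.

  _∈*_ : Name (ℕ × Bool) → Pred Cantor 0ℓ → Sentence
  τ ∈* D = ∃̇ λ (s : Σ[ s ∈ Seq ] [ s ] ⊆ D) → proj₁ s ⊏̇ τ

  AddsCohenReal : Set (lsuc (c ⊔ ℓ₂))
  AddsCohenReal = Σ[ r ∈ Name (ℕ × Bool) ]
    (⊩ IsFunction r) × (∀ D → Open D → Dense D → ⊩ (r ∈* D))

open Forcing public
  using (SplitsEverywhere; SigmaCentered; AddsCohenReal)

{-# OPTIONS --safe #-}

-- Assume that no nowhere dense non-principal ultrafilter exists.  Extend the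
-- n-th directed set to an ultrafilter V n on the set of conditions which
-- contains every dense open set.  Since P splits everywhere, there is a maximal
-- antichain of open sets missed by V n, one of which belongs to V i whenever V i
-- is distinguished from V n by a condition.  Through the index of the antichain,
-- V n induces a non-principal ultrafilter on ω, so some f n : ω → ^ω 2 maps all
-- its members to somewhere dense sets.  Refine these antichains successively to a
-- tree of cells and attach finite binary sequences to them: below a cell of level
-- n lying in V n, the k-th subcell appends f n k restricted to k; below other
-- cells nothing is appended.  Given a condition p, let m be least with p in V m;
-- then some cell of level m lies in V m, and since the values of f m on the
-- subcells compatible with p are somewhere dense, p can be strengthened so as to
-- push the sequence into any given dense open set.  So the union of the sequences
-- along the generic branch is a Cohen real.

module Submission where

open import Defs
open import Axiom.ExcludedMiddle using (ExcludedMiddle)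
open import Data.Bool.Base using (Bool; false; not)
open import Data.Bool.Properties using (not-¬)
open import Data.Empty using (⊥; ⊥-elim)
open import Data.Fin.Base using (toℕ; fromℕ<)
open import Data.Fin.Properties using (toℕ<n; toℕ-fromℕ<)
open import Data.List.Base using (List; []; _∷_; length)
open import Data.Nat.Base using (ℕ; zero; suc; _+_; _∸_; _≤_; _<_)
open import Data.Nat.Properties
open import Data.Product.Base using (Σ-syntax; ∃; ∃-syntax; _×_; _,_; proj₁; proj₂)
open import Data.Sum.Base using (_⊎_; inj₁; inj₂)
open import Data.Vec.Base using ([]; tabulate)
open import Data.Vec.Properties using (lookup∘tabulate)
open import Function.Base using (_∘_; id)
open import Function.Bundles using (Equivalence; Func)
open import Level using (0ℓ; _⊔_; lift; Lift) renaming (suc to lsuc)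
open import Relation.Binary.Bundles using (Preorder)
open import Relation.Binary.Definitions using (tri<; tri≈; tri>)
open import Relation.Binary.PropositionalEquality using (_≡_; refl; sym; trans; cong; subst)
open import Relation.Nullary.Decidable.Core
  using (yes; no; True; fromWitness; toWitness; decidable-stable)
open import Relation.Nullary.Negation.Core using (¬_)
open import Relation.Unary using (Pred; U; ∅; ∁; _∩_; _⊆_; _≐_; _≬_)
open import Relation.Unary.Relation.Binary.Equality using (≐-setoid)

-- Filters on an arbitrary set

record IsFilterOn {x} {X : Set x} (D : Pred (Pred X 0ℓ) 0ℓ) : Set (x ⊔ lsuc 0ℓ) where
  field
    whole  : D U
    upward : ∀ {A B} → A ⊆ B → D A → D B
    meet   : ∀ {A B} → D A → D B → D (A ∩ B)
    proper : ¬ D ∅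

record IsUltrafilterOn {x} {X : Set x} (D : Pred (Pred X 0ℓ) 0ℓ) : Set (x ⊔ lsuc 0ℓ) where
  field
    isFilterOn : IsFilterOn D
    ultra      : ∀ A → D A ⊎ D (∁ A)
  open IsFilterOn isFilterOn public

-- Initial segments and concatenation in Cantor space

Agree : ℕ → Cantor → Cantor → Set
Agree n x y = ∀ {i} → i < n → x i ≡ y i

agree⇒∈ : ∀ {n s} x y → Agree n x y → [ n , s ] y → [ n , s ] x
agree⇒∈ x y x≡y y∈s i = trans (x≡y (toℕ<n i)) (y∈s i)

_↾_ : Cantor → ℕ → Seq
x ↾ n = n , tabulate (x ∘ toℕ)

∈-↾ : ∀ x n → [ x ↾ n ] x
∈-↾ x n i = sym (lookup∘tabulate (x ∘ toℕ) i)

∈-↾⇒agree : ∀ {n} x y → [ y ↾ n ] x → Agree n x y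
∈-↾⇒agree x y x∈ i<n = subst (λ j → x j ≡ y j) (toℕ-fromℕ< i<n)
  (trans (x∈ (fromℕ< i<n)) (lookup∘tabulate (y ∘ toℕ) (fromℕ< i<n)))

glue : ℕ → Cantor → Cantor → Cantor
glue n x y i with i <? n
... | yes _ = x i
... | no _  = y (i ∸ n)

glue-< : ∀ n x y → Agree n (glue n x y) x
glue-< n x y {i} i<n with i <? n
... | yes _  = refl
... | no i≮n = ⊥-elim (i≮n i<n)

glue-+ : ∀ n x y i → glue n x y (n + i) ≡ y i
glue-+ n x y i with n + i <? n
... | yes n+i<n = ⊥-elim (m+n≮m n i n+i<n)
... | no _      = cong y (m+n∸m≡n n i)

below-or-beyond : ∀ n i → i < n ⊎ ∃[ j ] i ≡ n + j
below-or-beyond n i with i <? n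
... | yes i<n = inj₁ i<n
... | no i≮n  = inj₂ (i ∸ n , sym (m+[n∸m]≡n (≮⇒≥ i≮n)))

U-open : Open U
U-open _ = (0 , []) , (λ ()) , _

U-dense : Dense U
U-dense x _ x∈s = x , x∈s , _

-- Classical reasoning and resizing

module Classical (em : ∀ {ℓ} → ExcludedMiddle ℓ) where

  by-contradiction : ∀ {ℓ} {A : Set ℓ} → ¬ ¬ A → A
  by-contradiction = decidable-stable em

  -- Propositional resizing: it keeps all predicates Set₀-valued, whatever the
  -- levels of P.
  record Resized {ℓ} (A : Set ℓ) : Set where
    constructor mk
    field holds : True (em {P = A})

  resize : ∀ {ℓ} {A : Set ℓ} → A → Resized A
  resize a = mk (fromWitness a)

  unresize : ∀ {ℓ} {A : Set ℓ} → Resized A → A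
  unresize (mk a) = toWitness a

  -- The ultrafilter lemma

  module UltrafilterLemma
    (ac : ∀ {a ℓa b ℓb r} → AxiomOfChoice a ℓa b ℓb r)
    {x} {X : Set x} {F : Pred (Pred X 0ℓ) 0ℓ} (F-filter : IsFilterOn F)
    where

    private
      module F = IsFilterOn F-filter

      Family : Set (x ⊔ lsuc 0ℓ)
      Family = Pred (Pred X 0ℓ) 0ℓ

      Undecided : Family → Pred (Pred X 0ℓ) (x ⊔ lsuc 0ℓ)
      Undecided G A = ∀ C → G C → ¬ C ⊆ A × ¬ C ⊆ ∁ A

      -- The second alternative makes the relation total, so that choice applies; meeting a filter
      -- with `U` adds nothing to it.
      Chosen : Family → Pred X 0ℓ → Set (x ⊔ lsuc 0ℓ)
      Chosen G A = Undecided G A ⊎ (¬ ∃ (Undecided G) × A ≐ U)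

      undecided-resp : ∀ {G H A B} → G ≐ H → A ≐ B → Undecided G A → Undecided H B
      undecided-resp (_ , H⊆G) (A⊆B , B⊆A) und C C∈H =
        (λ C⊆B → proj₁ (und C (H⊆G C∈H)) (B⊆A ∘ C⊆B)) ,
        (λ C⊆∁B → proj₂ (und C (H⊆G C∈H)) (λ c a → C⊆∁B c (A⊆B a)))

      chosen-resp : ∀ {G H A B} → G ≐ H → A ≐ B → Chosen G A → Chosen H B
      chosen-resp G≐H A≐B (inj₁ und) = inj₁ (undecided-resp G≐H A≐B und)
      chosen-resp (G⊆H , H⊆G) (A⊆B , B⊆A) (inj₂ (none , _ , U⊆A)) =
        inj₂ ((λ (C , und) → none (C , undecided-resp (H⊆G , G⊆H) (id , id) und)) ,
              _ , A⊆B ∘ U⊆A)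

      chosen-exists : ∀ G → ∃ (Chosen G)
      chosen-exists G with em {P = ∃ (Undecided G)}
      ... | yes (A , und) = A , inj₁ und
      ... | no none       = U , inj₂ (none , id , id)

      choice = ac (≐-setoid (Pred X 0ℓ) 0ℓ) (≐-setoid X 0ℓ) Chosen chosen-resp chosen-exists

      open Func (proj₁ choice) using () renaming (to to new; cong to new-cong)

      new-chosen : ∀ G → Chosen G (new G)
      new-chosen = proj₂ choice

      step : Family → Family
      step G B = Resized (∃[ C ] G C × C ∩ new G ⊆ B)

      -- With `F` included, the empty join is `F`, the bottom of the tower.
      join : Pred Family 0ℓ → Family
      join S B = Resized (F B ⊎ ∃[ G ] S G × G B)

      -- The Bourbaki–Witt tower: its union is a fixed point of step, hence decides
      -- every set.
      data Tower : Pred Family (x ⊔ lsuc 0ℓ) where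
        tower-step : ∀ {G} → Tower G → Tower (step G)
        tower-join : ∀ {S} → S ⊆ Tower → Tower (join S)

      step-increasing : ∀ {G} → G ⊆ step G
      step-increasing G∋B = resize (_ , G∋B , proj₁)

      -- Both inclusions are assumed because `step` need not be monotone: the choice function only
      -- respects extensional equality of families.
      step-cong : ∀ {G H} → G ⊆ H → H ⊆ G → step G ⊆ step H
      step-cong G⊆H H⊆G B∈ with unresize B∈
      ... | C , C∈G , C∩new⊆B =
        resize (C , G⊆H C∈G ,
                λ (c , d) → C∩new⊆B (c , proj₂ (new-cong (G⊆H , H⊆G)) d))

      F⊆tower : ∀ {G} → Tower G → F ⊆ G
      F⊆tower (tower-step G∈T) B∈F = step-increasing (F⊆tower G∈T B∈F)
      F⊆tower (tower-join _) B∈F = resize (inj₁ B∈F)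

      join-upper : ∀ {S G} → S G → G ⊆ join S
      join-upper G∈S B∈G = resize (inj₂ (_ , G∈S , B∈G))

      join-least : ∀ {S} {H : Family} → F ⊆ H → (∀ {G} → S G → G ⊆ H) → join S ⊆ H
      join-least F⊆H S≤H B∈ with unresize B∈
      ... | inj₁ B∈F            = F⊆H B∈F
      ... | inj₂ (_ , G∈S , B∈G) = S≤H G∈S B∈G

      -- The extreme points of the Bourbaki-Witt argument. Every tower member turns out to be one,
      -- which makes the tower a chain.
      Extreme : Pred Family (x ⊔ lsuc 0ℓ)
      Extreme G = ∀ {H} → Tower H → H ⊆ G → ¬ G ⊆ H → step H ⊆ G

      -- Induction on `H`: extremeness keeps a step from jumping past `G`, and a join either has a
      -- member above `step G` or lies below `G`.
      extreme-comparable : ∀ {G} → Tower G → Extreme G → ∀ {H} → Tower H → H ⊆ G ⊎ step G ⊆ H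
      extreme-comparable {G} G∈T ext (tower-step {H} H∈T) with extreme-comparable G∈T ext H∈T
      ... | inj₂ sG⊆H = inj₂ (step-increasing ∘ sG⊆H)
      ... | inj₁ H⊆G with em {P = G ⊆ H}
      ...   | yes G⊆H = inj₂ (step-cong G⊆H H⊆G)
      ...   | no G⊈H  = inj₁ (ext H∈T H⊆G G⊈H)
      extreme-comparable {G} G∈T ext (tower-join {S} S⊆T)
        with em {P = ∃[ H ] S H × step G ⊆ H}
      ... | yes (H , H∈S , sG⊆H) = inj₂ (join-upper H∈S ∘ sG⊆H)
      ... | no none = inj₁ (join-least (F⊆tower G∈T) below)
        where
        below : ∀ {H} → S H → H ⊆ G
        below H∈S with extreme-comparable G∈T ext (S⊆T H∈S)
        ... | inj₁ H⊆G  = H⊆G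
        ... | inj₂ sG⊆H = ⊥-elim (none (_ , H∈S , sG⊆H))

      tower-extreme : ∀ {G} → Tower G → Extreme G
      tower-extreme (tower-step {G} G∈T) {H} H∈T H⊆sG sG⊈H
        with extreme-comparable G∈T (tower-extreme G∈T) H∈T
      ... | inj₂ sG⊆H = ⊥-elim (sG⊈H sG⊆H)
      ... | inj₁ H⊆G with em {P = G ⊆ H}
      ...   | yes G⊆H = step-cong H⊆G G⊆H
      ...   | no G⊈H  = step-increasing ∘ tower-extreme G∈T H∈T H⊆G G⊈H
      tower-extreme (tower-join {S} S⊆T) {H} H∈T H⊆J J⊈H
        with em {P = ∃[ G ] S G × ¬ G ⊆ H}
      ... | no none = ⊥-elim (J⊈H (join-least (F⊆tower H∈T)
                        λ {G} G∈S → by-contradiction λ G⊈H → none (G , G∈S , G⊈H)))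
      ... | yes (G , G∈S , G⊈H)
        with extreme-comparable (S⊆T G∈S) (tower-extreme (S⊆T G∈S)) H∈T
      ...   | inj₁ H⊆G  = join-upper G∈S ∘ tower-extreme (S⊆T G∈S) H∈T H⊆G G⊈H
      ...   | inj₂ sG⊆H = ⊥-elim (G⊈H (sG⊆H ∘ step-increasing))

      tower-linear : ∀ {G H} → Tower G → Tower H → G ⊆ H ⊎ H ⊆ G
      tower-linear G∈T H∈T with extreme-comparable G∈T (tower-extreme G∈T) H∈T
      ... | inj₁ H⊆G  = inj₂ H⊆G
      ... | inj₂ sG⊆H = inj₁ (sG⊆H ∘ step-increasing)

      tower-filter : ∀ {G} → Tower G → IsFilterOn G
      tower-filter (tower-step {G} G∈T) = record
        { whole  = resize (U , G.whole , _)
        ; upward = λ A⊆B A∈ → let (C , C∈G , ⊆A) = unresize A∈ in resize (C , C∈G , A⊆B ∘ ⊆A)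
        ; meet   = λ A∈ B∈ →
            let (C , C∈G , ⊆A) = unresize A∈
                (D , D∈G , ⊆B) = unresize B∈
            in resize (C ∩ D , G.meet C∈G D∈G ,
                       λ ((c , d) , e) → ⊆A (c , e) , ⊆B (d , e))
        ; proper = proper
        }
        where
        module G = IsFilterOn (tower-filter G∈T)
        proper : ¬ step G ∅
        proper ∅∈ with unresize ∅∈ | new-chosen G
        -- The chosen set is undecided, so no member of `G` is disjoint from it.
        ... | C , C∈G , ⊆∅ | inj₁ und = proj₂ (und C C∈G) (λ c e → ⊆∅ (c , e))
        ... | C , C∈G , ⊆∅ | inj₂ (_ , _ , U⊆new) =
          G.proper (G.upward (λ c → ⊆∅ (c , U⊆new _)) C∈G)
      tower-filter (tower-join {S} S⊆T) = record
        { whole  = resize (inj₁ F.whole)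
        ; upward = upward
        ; meet   = meet
        ; proper = proper
        }
        where
        module S {G} (G∈S : S G) = IsFilterOn (tower-filter (S⊆T G∈S))
        upward : ∀ {A B} → A ⊆ B → join S A → join S B
        upward A⊆B A∈ with unresize A∈
        ... | inj₁ A∈F             = resize (inj₁ (F.upward A⊆B A∈F))
        ... | inj₂ (_ , G∈S , A∈G) = resize (inj₂ (_ , G∈S , S.upward G∈S A⊆B A∈G))
        meet : ∀ {A B} → join S A → join S B → join S (A ∩ B)
        meet A∈ B∈ with unresize A∈ | unresize B∈
        ... | inj₁ A∈F | inj₁ B∈F = resize (inj₁ (F.meet A∈F B∈F))
        ... | inj₁ A∈F | inj₂ (_ , G∈S , B∈G) =
          join-upper G∈S (S.meet G∈S (F⊆tower (S⊆T G∈S) A∈F) B∈G)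
        ... | inj₂ (_ , G∈S , A∈G) | inj₁ B∈F =
          join-upper G∈S (S.meet G∈S A∈G (F⊆tower (S⊆T G∈S) B∈F))
        -- Linearity of the tower puts both sets into a single member of `S`.
        ... | inj₂ (_ , G∈S , A∈G) | inj₂ (_ , H∈S , B∈H)
          with tower-linear (S⊆T G∈S) (S⊆T H∈S)
        ...   | inj₁ G⊆H = join-upper H∈S (S.meet H∈S (G⊆H A∈G) B∈H)
        ...   | inj₂ H⊆G = join-upper G∈S (S.meet G∈S A∈G (H⊆G B∈H))
        proper : ¬ join S ∅
        proper ∅∈ with unresize ∅∈
        ... | inj₁ ∅∈F             = F.proper ∅∈F
        ... | inj₂ (_ , G∈S , ∅∈G) = S.proper G∈S ∅∈G

      top : Family
      top = join (λ G → Resized (Tower G))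

      top∈tower : Tower top
      top∈tower = tower-join unresize

      top-ultra : ∀ A → top A ⊎ top (∁ A)
      top-ultra A with em {P = ∃[ C ] top C × (C ⊆ A ⊎ C ⊆ ∁ A)}
      ... | yes (C , C∈ , inj₁ C⊆A)  = inj₁ (IsFilterOn.upward (tower-filter top∈tower) C⊆A C∈)
      ... | yes (C , C∈ , inj₂ C⊆∁A) = inj₂ (IsFilterOn.upward (tower-filter top∈tower) C⊆∁A C∈)
      ... | no none = ⊥-elim (absurd (new-chosen top))
        where
        -- `step top` is itself in the tower, hence included in the join of the whole tower.
        new∈top : top (new top)
        new∈top = join-upper {G = step top} (resize (tower-step top∈tower))
          (resize (U , IsFilterOn.whole (tower-filter top∈tower) , proj₂))
        absurd : ¬ Chosen top (new top)
        absurd (inj₁ und)        = proj₁ (und _ new∈top) id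
        absurd (inj₂ (all , _)) = all (A , λ C C∈ →
          (λ C⊆A → none (C , C∈ , inj₁ C⊆A)) , (λ C⊆∁A → none (C , C∈ , inj₂ C⊆∁A)))

    extend-to-ultrafilter : ∃[ D ] IsUltrafilterOn D × F ⊆ D
    extend-to-ultrafilter =
      top , record { isFilterOn = tower-filter top∈tower ; ultra = top-ultra } ,
      F⊆tower top∈tower

  -- Sequences with somewhere dense values

  -- The index must be large because only the first `k` entries of `f k` will be appended to a
  -- label.
  somewhere-dense-values : ∀ {f X} → ¬ NowhereDense (Image f X) →
    ∃[ a ] ∃[ z ] ∀ y → Agree a y z → ∀ b →
    ∃[ k ] X k × b ≤ k × Agree b (f k) y
  somewhere-dense-values {f} {X} ¬nwd with by-contradiction (λ none → ¬nwd λ x x∈ → none (x , x∈))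
  ... | z , (a , s) , z∈s , s⊆closure = a , z , values
    where
    values : ∀ y → Agree a y z → ∀ b → ∃[ k ] X k × b ≤ k × Agree b (f k) y
    values y y≡z b =
      -- A prefix of length `n + n` contains the diagonal position `n + k` for every `k < n`.
      large (s⊆closure {y′} (agree⇒∈ {s = s} y′ z y′≡z z∈s) (y′ ↾ (n + n)) (∈-↾ y′ (n + n)))
      where
      n = a + b
      b≤n = m≤n+m b a
      -- Differs from f k for every k < n, so only values k ≥ n of the index remain.
      y′ = glue n y λ k → not (f k (n + k))
      y′≡z : Agree a y′ z
      y′≡z i<a = trans (glue-< n y _ (<-≤-trans i<a (m≤m+n a b))) (y≡z i<a)
      large : [ y′ ↾ (n + n) ] ≬ Image f X → ∃[ k ] X k × b ≤ k × Agree b (f k) y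
      large (x , x∈ , k , k∈X , fk≡x) =
        k , k∈X , ≤-trans b≤n n≤k ,
        λ i<b → trans (fk≡y′ (<-≤-trans i<b (≤-trans b≤n (m≤m+n n n))))
                      (glue-< n y _ (<-≤-trans i<b b≤n))
        where
        fk≡y′ : Agree (n + n) (f k) y′
        fk≡y′ {i} i<n+n = trans (fk≡x i) (∈-↾⇒agree x y′ x∈ i<n+n)
        n≤k : n ≤ k
        n≤k = ≮⇒≥ λ k<n → not-¬ refl
          (trans (fk≡y′ (+-monoʳ-< n k<n)) (glue-+ n y _ k))

  -- Density gives a point `d` of `D` that starts with `n` entries of `x` and then `a` entries of
  -- `z`. A neighbourhood of `d` lies in `D`, and some `f k` follows the tail of `d` far enough to
  -- enter it.
  dense-append : ∀ {f X D} n x → ¬ NowhereDense (Image f X) → Open D → Dense D → ∀ b →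
    ∃[ k ] X k × b ≤ n + k × Σ[ s ∈ Seq ] [ s ] ⊆ D × proj₁ s ≤ n + k × [ s ] (glue n x (f k))
  dense-append {f} {X} {D} n x ¬nwd D-open D-dense b =
    let (a , z , values) = somewhere-dense-values ¬nwd
        u = glue n x z
        (d , d∈ , d∈D) = D-dense u (u ↾ (n + a)) (∈-↾ u (n + a))
        d≡u = ∈-↾⇒agree d u d∈
        ((l , s) , d∈s , s⊆D) = D-open d∈D
        -- The summand `b` makes the new sequence long enough, and `l` makes it reach the end of
        -- `s`.
        (k , k∈X , b+l≤k , fk≡d) = values (λ i → d (n + i))
          (λ i<a → trans (d≡u (+-monoʳ-< n i<a)) (glue-+ n x z _)) (b + l)
        b+l≤n+k = ≤-trans b+l≤k (m≤n+m k n)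
    in k , k∈X , ≤-trans (m≤m+n b l) b+l≤n+k ,
       (l , s) , s⊆D , ≤-trans (m≤n+m l b) b+l≤n+k ,
       agree⇒∈ {s = s} (glue n x (f k)) d
         (glued (λ i<n → trans (d≡u (<-≤-trans i<n (m≤m+n n a))) (glue-< n x z i<n))
                (λ j<l → fk≡d (<-≤-trans j<l (m≤n+m l b))))
         d∈s
    where
    glued : ∀ {d y l} → Agree n d x → Agree l y (λ i → d (n + i)) → Agree l (glue n x y) d
    glued d≡x y≡d {i} i<l with below-or-beyond n i
    ... | inj₁ i<n        = trans (glue-< n x _ i<n) (sym (d≡x i<n))
    ... | inj₂ (j , refl) = trans (glue-+ n x _ j) (y≡d (≤-<-trans (m≤n+m j n) i<l))

  -- Open sets of conditions

  module Construction {c ℓ₁ ℓ₂} (P : Preorder c ℓ₁ ℓ₂) (splits : SplitsEverywhere P) where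
    open Preorder P using (Carrier; _≲_) renaming (refl to ≲-refl; trans to ≲-trans)
    open Forcing P hiding (AddsCohenReal; SigmaCentered; SplitsEverywhere)

    Upward : Pred Carrier 0ℓ → Set _
    Upward d = ∀ {p q} → p ≲ q → d p → d q

    DenseIn : Pred Carrier 0ℓ → Set _
    DenseIn d = ∀ p → ∃[ q ] p ≲ q × d q

    cone : Carrier → Pred Carrier 0ℓ
    cone p q = Resized (p ≲ q)

    cone-upward : ∀ p → Upward (cone p)
    cone-upward p q≲r p≲q = resize (≲-trans (unresize p≲q) q≲r)

    -- The interior of the complement, with the upward closed sets as the open sets.
    _ᶜ : Pred Carrier 0ℓ → Pred Carrier 0ℓ
    (w ᶜ) p = Resized (∀ q → p ≲ q → ¬ w q)

    ᶜ-upward : ∀ w → Upward (w ᶜ)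
    ᶜ-upward w p≲q p∈ = resize λ r q≲r → unresize p∈ r (≲-trans p≲q q≲r)

    -- Ultrafilters containing all dense open sets

    module Generic
      (V : ℕ → Pred (Pred Carrier 0ℓ) 0ℓ)
      (V-ultra : ∀ n → IsUltrafilterOn (V n))
      (V-dense : ∀ n {d} → Upward d → DenseIn d → V n d)
      (V-covers : ∀ p → ∃[ n ] V n (cone p))
      where

      module V n = IsUltrafilterOn (V-ultra n)

      nonempty : ∀ n {d} → V n d → ∃ d
      nonempty n d∈V = by-contradiction λ none →
        V.proper n (V.upward n (λ p∈d → none (_ , p∈d)) d∈V)

      -- The union of `w` and `w ᶜ` is dense open and so belongs to `V n`.
      dec-ᶜ : ∀ n {w} → Upward w → V n w ⊎ V n (w ᶜ)
      dec-ᶜ n {w} w↑ with V.ultra n w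
      ... | inj₁ w∈V  = inj₁ w∈V
      ... | inj₂ ∁w∈V = inj₂ (V.upward n both (V.meet n ∁w∈V (V-dense n up dense)))
        where
        d : Pred Carrier 0ℓ
        d p = w p ⊎ (w ᶜ) p
        up : Upward d
        up p≲q (inj₁ p∈w)  = inj₁ (w↑ p≲q p∈w)
        up p≲q (inj₂ p∈wᶜ) = inj₂ (ᶜ-upward w p≲q p∈wᶜ)
        dense : DenseIn d
        dense p with em {P = ∃[ q ] p ≲ q × w q}
        ... | yes (q , p≲q , q∈w) = q , p≲q , inj₁ q∈w
        ... | no none = p , ≲-refl , inj₂ (resize λ q p≲q q∈w → none (q , p≲q , q∈w))
        both : ∁ w ∩ d ⊆ w ᶜ
        both (p∉w , inj₁ p∈w)  = ⊥-elim (p∉w p∈w)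
        both (p∉w , inj₂ p∈wᶜ) = p∈wᶜ

      -- The antichain missed by the n-th ultrafilter

      Separates : ℕ → ℕ → Pred (Pred Carrier 0ℓ) _
      Separates n i w = Upward w × ¬ V n w × (∀ p → V i (cone p) → ¬ V n (cone p) → V i w)

      -- Any one cone in `V i` but not in `V n` serves for all of them; if there is none, the last
      -- clause is vacuous and `∅` will do.
      separator : ∀ n i → ∃ (Separates n i)
      separator n i with em {P = ∃[ p ] V i (cone p) × ¬ V n (cone p)}
      ... | yes (p , p∈i , p∉n) = cone p , cone-upward p , p∉n , λ _ _ _ → p∈i
      ... | no none = ∅ , (λ _ ()) , V.proper n , λ p p∈i p∉n → ⊥-elim (none (p , p∈i , p∉n))

      sep : ℕ → ℕ → Pred Carrier 0ℓ
      sep n i = proj₁ (separator n i)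

      sep-upward : ∀ n i → Upward (sep n i)
      sep-upward n i = proj₁ (proj₂ (separator n i))

      avoid : ℕ → ℕ → Pred Carrier 0ℓ
      avoid n zero    = U
      avoid n (suc k) = avoid n k ∩ (sep n k ᶜ)

      -- For fixed n, an antichain that is maximal and is missed by V n.
      piece : ℕ → ℕ → Pred Carrier 0ℓ
      piece n k = sep n k ∩ avoid n k

      avoid-upward : ∀ n k → Upward (avoid n k)
      avoid-upward n zero    _   _       = _
      avoid-upward n (suc k) p≲q (a , b) = avoid-upward n k p≲q a , ᶜ-upward (sep n k) p≲q b

      piece-upward : ∀ n k → Upward (piece n k)
      piece-upward n k p≲q (a , b) = sep-upward n k p≲q a , avoid-upward n k p≲q b

      avoid-< : ∀ n {j k} → j < k → avoid n k ⊆ sep n j ᶜ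
      avoid-< n {j} {suc k} j<1+k (a , b) with m≤n⇒m<n∨m≡n (≤-pred j<1+k)
      ... | inj₁ j<k  = avoid-< n j<k a
      ... | inj₂ refl = b

      piece-unique : ∀ n {j k p} → piece n j p → piece n k p → j ≡ k
      piece-unique n {j} {k} (p∈j , p∉<j) (p∈k , p∉<k) with <-cmp j k
      ... | tri≈ _ j≡k _ = j≡k
      ... | tri< j<k _ _ = ⊥-elim (unresize (avoid-< n j<k p∉<k) _ ≲-refl p∈j)
      ... | tri> _ _ k<j = ⊥-elim (unresize (avoid-< n k<j p∉<j) _ ≲-refl p∈k)

      piece∉V : ∀ n k → ¬ V n (piece n k)
      piece∉V n k piece∈V = proj₁ (proj₂ (proj₂ (separator n k))) (V.upward n proj₁ piece∈V)

      -- Go through the separators in order: the first one in `V i` yields the piece, since `V i`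
      -- contains the exteriors of those before it. The search ends by stage `i`, because `sep n i`
      -- is in `V i`.
      piece∈V : ∀ n {i p} → V i (cone p) → ¬ V n (cone p) → ∃[ k ] V i (piece n k)
      piece∈V n {i} p∈i p∉n with avoid-or-piece i
        where
        avoid-or-piece : ∀ k → V i (avoid n k) ⊎ ∃[ j ] V i (piece n j)
        avoid-or-piece zero = inj₁ (V.whole i)
        avoid-or-piece (suc k) with avoid-or-piece k
        ... | inj₂ found = inj₂ found
        ... | inj₁ avoid∈V with dec-ᶜ i (sep-upward n k)
        ...   | inj₁ sep∈V  = inj₂ (k , V.meet i sep∈V avoid∈V)
        ...   | inj₂ sepᶜ∈V = inj₁ (V.meet i avoid∈V sepᶜ∈V)
      ... | inj₂ found   = found
      ... | inj₁ avoid∈V =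
        i , V.meet i (proj₂ (proj₂ (proj₂ (separator n i))) _ p∈i p∉n) avoid∈V

      -- Cones of incompatible conditions are disjoint, so `V n` omits one of the two.
      outside : ∀ n p → ∃[ q ] p ≲ q × ¬ V n (cone q)
      outside n p with splits p
      ... | q , r , p≲q , p≲r , q⊥r with em {P = V n (cone q)}
      ...   | no q∉V  = q , p≲q , q∉V
      ...   | yes q∈V = r , p≲r , λ r∈V →
        let s , q≲s , r≲s = nonempty n (V.meet n q∈V r∈V)
        in q⊥r (s , unresize q≲s , unresize r≲s)

      pieces : ℕ → Pred ℕ 0ℓ → Pred Carrier 0ℓ
      pieces n X p = ∃[ k ] X k × piece n k p

      -- Maximality of the antichain: above `p` there is a cone outside `V n`; a `V i` containing
      -- that cone also contains a piece, and the two must meet.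
      pieces-dense : ∀ n → V n (pieces n U)
      pieces-dense n = V-dense n (λ p≲q (k , _ , p∈k) → k , _ , piece-upward n k p≲q p∈k) dense
        where
        dense : DenseIn (pieces n U)
        dense p with outside n p
        ... | q , p≲q , q∉n with V-covers q
        ...   | i , q∈i with piece∈V n q∈i q∉n
        ...     | k , k∈i with nonempty i (V.meet i q∈i k∈i)
        ...       | r , q≲r , r∈k = r , ≲-trans p≲q (unresize q≲r) , k , _ , r∈k

      -- The induced ultrafilters on the natural numbers

      induced : ℕ → Pred (Pred ℕ 0ℓ) 0ℓ
      induced n X = V n (pieces n X)

      induced-ultra : ∀ n → IsUltrafilter (induced n)
      induced-ultra n = record
        { isFilter = record
          { whole  = pieces-dense n
          ; upward = λ A⊆B → V.upward n λ (k , k∈A , p∈k) → k , A⊆B k∈A , p∈k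
          ; meet   = λ {A} {B} A∈ B∈ → V.upward n
              (λ ((j , j∈A , p∈j) , (k , k∈B , p∈k)) →
                j , (j∈A , subst B (piece-unique n p∈k p∈j) k∈B) , p∈j)
              (V.meet n A∈ B∈)
          ; proper = λ ∅∈ → V.proper n (V.upward n (λ ()) ∅∈)
          }
        ; ultra = ultra
        }
        where
        ultra : ∀ A → induced n A ⊎ induced n (∁ A)
        ultra A with V.ultra n (pieces n A)
        ... | inj₁ A∈  = inj₁ A∈
        ... | inj₂ ∁A∈ = inj₂ (V.upward n
          (λ (p∉A , (k , _ , p∈k)) → k , (λ k∈A → p∉A (k , k∈A , p∈k)) , p∈k)
          (V.meet n ∁A∈ (pieces-dense n)))

      -- No singleton is in the ultrafilter, since `V n` misses each piece; so a generating set
      -- would omit every number.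
      induced-nonprincipal : ∀ n → ¬ Principal (induced n)
      induced-nonprincipal n (B , generated) =
        IsFilter.proper D.isFilter (Equivalence.from (generated ∅) λ {k} k∈B →
          Equivalence.to (generated (∁ (_≡ k))) (cofinite k) k∈B refl)
        where
        module D = IsUltrafilter (induced-ultra n)
        cofinite : ∀ k → induced n (∁ (_≡ k))
        cofinite k with D.ultra (_≡ k)
        ... | inj₂ ∁k∈D = ∁k∈D
        ... | inj₁ k∈D  = ⊥-elim (piece∉V n k (V.upward n (λ { (_ , refl , p∈k) → p∈k }) k∈D))

      -- The tree of cells and the name of the Cohen real

      module CohenName
        (f : ℕ → ℕ → Cantor)
        (f-somewhere-dense : ∀ n {X} → induced n X → ¬ NowhereDense (Image (f n) X))
        where

        -- Nodes are listed from the last level down to level 0.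
        cell : List ℕ → Pred Carrier 0ℓ
        cell []      = U
        cell (k ∷ ν) = cell ν ∩ piece (length ν) k

        -- A finite sequence is represented by its length and any extension of it.
        label : List ℕ → ℕ × Cantor
        label [] = 0 , λ _ → false
        label (k ∷ ν) with em {P = V (length ν) (cell ν)}
        ... | yes _ = let (n , x) = label ν in n + k , glue n x (f (length ν) k)
        ... | no _  = label ν

        label-∷ : ∀ ν k → V (length ν) (cell ν) →
          label (k ∷ ν) ≡ (let (n , x) = label ν in n + k , glue n x (f (length ν) k))
        label-∷ ν k ν∈V with em {P = V (length ν) (cell ν)}
        ... | yes _  = refl
        ... | no ν∉V = ⊥-elim (ν∉V ν∈V)

        Bit : List ℕ → ℕ → Bool → Set
        Bit ν i b = let (n , x) = label ν in i < n × x i ≡ b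

        bit-extend : ∀ {ν k i b} → Bit ν i b → Bit (k ∷ ν) i b
        bit-extend {ν} {k} (i<n , xi≡b) with em {P = V (length ν) (cell ν)}
        ... | yes _ = let (n , x) = label ν in
          <-≤-trans i<n (m≤m+n n k) , trans (glue-< n x _ i<n) xi≡b
        ... | no _  = i<n , xi≡b

        cell-upward : ∀ ν → Upward (cell ν)
        cell-upward []      _   _       = _
        cell-upward (k ∷ ν) p≲q (a , b) = cell-upward ν p≲q a , piece-upward (length ν) k p≲q b

        cell-unique : ∀ {μ ν p} → length μ ≡ length ν → cell μ p → cell ν p → μ ≡ ν
        cell-unique {[]}    {[]}    _  _ _ = refl
        cell-unique {j ∷ μ} {k ∷ ν} eq (p∈μ , p∈j) (p∈ν , p∈k)
          with cell-unique {μ} {ν} (suc-injective eq) p∈μ p∈ν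
        ... | refl = cong (_∷ μ) (piece-unique (length μ) p∈j p∈k)

        -- Nodes whose cells share a condition lie on one branch, along which labels only get
        -- longer.
        bit-mono : ∀ {μ ν p i b} → length μ ≤ length ν → cell μ p → cell ν p → Bit μ i b → Bit ν i b
        bit-mono {μ} {ν} ∣μ∣≤∣ν∣ p∈μ p∈ν bit with m≤n⇒m<n∨m≡n ∣μ∣≤∣ν∣
        ... | inj₂ eq with cell-unique {μ} {ν} eq p∈μ p∈ν
        ...   | refl = bit
        bit-mono {μ} {k ∷ ν} _ p∈μ (p∈ν , _) bit | inj₁ ∣μ∣<1+∣ν∣ =
          bit-extend {ν} (bit-mono {μ} {ν} (≤-pred ∣μ∣<1+∣ν∣) p∈μ p∈ν bit)

        bit-functional : ∀ {μ ν p i b b′} → cell μ p → cell ν p → Bit μ i b → Bit ν i b′ → b ≡ b′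
        bit-functional {μ} {ν} p∈μ p∈ν bit bit′ with ≤-total (length μ) (length ν)
        ... | inj₁ μ≤ν = trans (sym (proj₂ (bit-mono {μ} {ν} μ≤ν p∈μ p∈ν bit))) (proj₂ bit′)
        ... | inj₂ ν≤μ = trans (sym (proj₂ bit)) (proj₂ (bit-mono {ν} {μ} ν≤μ p∈ν p∈μ bit′))

        -- By minimality `p` distinguishes `V m` from all earlier ultrafilters, so `V m` contains a
        -- cell of each level up to `m`.
        least-level : ∀ p → ∃[ m ] V m (cone p) × (∀ {i} → i < m → ¬ V i (cone p))
        least-level p = let (n , p∈n) = V-covers p in descend n (suc n) (n<1+n n) p∈n
          where
          descend : ∀ n b → n < b → V n (cone p) →
                    ∃[ m ] V m (cone p) × (∀ {i} → i < m → ¬ V i (cone p))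
          descend n (suc b) n<1+b p∈n with em {P = ∃[ i ] i < n × V i (cone p)}
          ... | yes (i , i<n , p∈i) = descend i b (<-≤-trans i<n (≤-pred n<1+b)) p∈i
          ... | no none = n , p∈n , λ i<n p∈i → none (_ , i<n , p∈i)

        cell∈V : ∀ {m p} → V m (cone p) → (∀ {i} → i < m → ¬ V i (cone p)) →
                 ∀ n → n ≤ m → ∃[ ν ] length ν ≡ n × V m (cell ν)
        cell∈V {m} p∈m p∉<m zero    _   = [] , refl , V.whole m
        cell∈V {m} p∈m p∉<m (suc n) n<m with cell∈V p∈m p∉<m n (<⇒≤ n<m)
        ... | ν , refl , ν∈V with piece∈V n p∈m (p∉<m n<m)
        ...   | k , k∈V = k ∷ ν , refl , V.meet m ν∈V k∈V

        Decides : Pred Cantor 0ℓ → ℕ → ℕ × Cantor → Set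
        Decides D b (n , x) = b ≤ n × Σ[ s ∈ Seq ] [ s ] ⊆ D × proj₁ s ≤ n × [ s ] x

        decide-prefix : ∀ p {D} → Open D → Dense D → ∀ b →
          ∃[ q ] p ≲ q × ∃[ ν ] cell ν q × Decides D b (label ν)
        decide-prefix p {D} D-open D-dense b =
          let (m , p∈m , p∉<m) = least-level p
              (ν , ∣ν∣≡m , ν∈V) = cell∈V p∈m p∉<m m ≤-refl
          -- The level of `ν` is the index of the ultrafilter containing its cell, so labels do grow
          -- just below `ν`.
          in at-cell ν (subst (λ m → V m (cone p)) (sym ∣ν∣≡m) p∈m)
                       (subst (λ m → V m (cell ν)) (sym ∣ν∣≡m) ν∈V)
          where
          at-cell : ∀ ν → V (length ν) (cone p) → V (length ν) (cell ν) →
            ∃[ q ] p ≲ q × ∃[ ν ] cell ν q × Decides D b (label ν)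
          at-cell ν p∈V ν∈V =
            let (k , k-reachable , decides) = dense-append n x (f-somewhere-dense m reachable)
                                                D-open D-dense b
                (q , p≲q , q∈) = unresize k-reachable
            in q , p≲q , k ∷ ν , q∈ , subst (Decides D b) (sym (label-∷ ν k ν∈V)) decides
            where
            m = length ν
            n = proj₁ (label ν)
            x = proj₂ (label ν)
            Reachable : Pred ℕ 0ℓ
            Reachable k = Resized (∃[ q ] p ≲ q × cell (k ∷ ν) q)
            -- Were the unreachable indices in the ultrafilter, their pieces would meet `cell ν` and
            -- `cone p` in a condition that makes its own index reachable.
            reachable : induced m Reachable
            reachable with IsUltrafilter.ultra (induced-ultra m) Reachable
            ... | inj₁ reach∈ = reach∈
            ... | inj₂ unreach∈ with nonempty m (V.meet m unreach∈ (V.meet m ν∈V p∈V))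
            ...   | q , (k , unreachable , q∈k) , q∈ν , p≲q =
              ⊥-elim (unreachable (resize (q , unresize p≲q , q∈ν , q∈k)))

        r : Name (ℕ × Bool)
        r (i , b) p = Lift _ (∃[ ν ] cell ν p × Bit ν i b)

        bit⇒∈̇ : ∀ ν {p i b} → cell ν p → Bit ν i b → ((i , b) ∈̇ r) p
        bit⇒∈̇ ν {p} p∈ν bit q p≲q = q , ≲-refl , p , lift (ν , p∈ν , bit) , p≲q

        r-function : ⊩ IsFunction r
        r-function p = total , functional
          where
          total : ∀ i q → p ≲ q → ∃[ q′ ] q ≲ q′ × ∃[ b ] ((i , b) ∈̇ r) q′
          total i q _ =
            -- The whole space as dense open set leaves just the length bound; length `suc i`
            -- includes position `i`.
            let (q′ , q≲q′ , ν , q′∈ν , i<n , _) = decide-prefix q (λ {x} → U-open {x}) U-dense (suc i)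
            in q′ , q≲q′ , proj₂ (label ν) i , bit⇒∈̇ ν q′∈ν (i<n , refl)
          functional : ∀ i b b′ q → p ≲ q → ((i , b) ∈̇ r) q × ((i , b′) ∈̇ r) q → Lift _ (b ≡ b′)
          functional i b b′ q _ (b∈ , b′∈) =
            -- The second membership is applied at `q₁`, so that `q₂` extends both `p₁` and `p₂`.
            let (q₁ , q≲q₁ , p₁ , lift (μ , p₁∈μ , bit) , p₁≲q₁)   = b∈ q ≲-refl
                (q₂ , q₁≲q₂ , p₂ , lift (ν , p₂∈ν , bit′) , p₂≲q₂) = b′∈ q₁ q≲q₁
            in lift (bit-functional {μ} {ν} (cell-upward μ (≲-trans p₁≲q₁ q₁≲q₂) p₁∈μ)
                                            (cell-upward ν p₂≲q₂ p₂∈ν) bit bit′)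

        r-generic : ∀ D → Open D → Dense D → ⊩ (r ∈* D)
        r-generic D D-open D-dense p q _ = prefix-in-D (decide-prefix q D-open D-dense 0)
          where
          prefix-in-D : ∃[ q′ ] q ≲ q′ × ∃[ ν ] cell ν q′ × Decides D 0 (label ν) →
            ∃[ q′ ] q ≲ q′ × Σ[ s ∈ (Σ[ s ∈ Seq ] [ s ] ⊆ D) ] (proj₁ s ⊏̇ r) q′
          prefix-in-D (q′ , q≲q′ , ν , q′∈ν , _ , s , s⊆D , l≤n , x∈s) =
            q′ , q≲q′ , (s , s⊆D) , λ i → bit⇒∈̇ ν q′∈ν (<-≤-trans (toℕ<n i) l≤n , x∈s i)

        adds-Cohen-real : AddsCohenReal P
        adds-Cohen-real = r , r-function , r-generic

    -- Ultrafilters from the directed sets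

    module SigmaCenteredUltrafilters
      (ac : ∀ {a ℓa b ℓb r} → AxiomOfChoice a ℓa b ℓb r)
      (A : ℕ → Pred Carrier (c ⊔ ℓ₂)) (A-directed : ∀ n → Directed (A n))
      (A-covers : ∀ p → ∃[ n ] A n p)
      (p₀ : Carrier)
      where

      generated : ℕ → Pred (Pred Carrier 0ℓ) 0ℓ
      generated n S = Resized (∃[ d ] Upward d × DenseIn d × ∃[ q ] A n q × cone q ∩ d ⊆ S)

      -- Directedness replaces two cones by one, and two dense open sets meet in a dense open set by
      -- extending twice. Properness holds because `d` has a member above `q`.
      generated-filter : ∀ {n a} → A n a → IsFilterOn (generated n)
      generated-filter {n} {a} a∈A = record
        { whole  = resize (U , _ , (λ p → p , ≲-refl , _) , a , a∈A , _)
        ; upward = λ S⊆T S∈ → let (d , d↑ , dd , q , q∈A , ⊆S) = unresize S∈ in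
            resize (d , d↑ , dd , q , q∈A , S⊆T ∘ ⊆S)
        ; meet   = λ S∈ T∈ →
            let (d , d↑ , dd , q , q∈A , ⊆S) = unresize S∈
                (e , e↑ , ed , q′ , q′∈A , ⊆T) = unresize T∈
                (r , r∈A , q≲r , q′≲r) = A-directed n q∈A q′∈A
            in resize (d ∩ e , (λ p≲q (a , b) → d↑ p≲q a , e↑ p≲q b) ,
                 (λ p → let (p₁ , p≲p₁ , p₁∈d) = dd p
                            (p₂ , p₁≲p₂ , p₂∈e) = ed p₁
                        in p₂ , ≲-trans p≲p₁ p₁≲p₂ , d↑ p₁≲p₂ p₁∈d , p₂∈e) ,
                 r , r∈A ,
                 λ (r≲p , p∈d , p∈e) → ⊆S (cone-mono q≲r r≲p , p∈d) ,
                                       ⊆T (cone-mono q′≲r r≲p , p∈e))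
        ; proper = λ ∅∈ →
            let (d , _ , dd , q , _ , ⊆∅) = unresize ∅∈
                (r , q≲r , r∈d) = dd q
            in ⊆∅ (resize q≲r , r∈d)
        }
        where
        cone-mono : ∀ {q r} → q ≲ r → cone r ⊆ cone q
        cone-mono q≲r r≲p = resize (≲-trans q≲r (unresize r≲p))

      -- Some A n may be empty, in which case its index is redirected.
      inhabited : ∀ n → ∃[ m ] ∃ (A m) × A n ⊆ A m
      inhabited n with em {P = ∃ (A n)}
      ... | yes nonempty = n , nonempty , id
      ... | no empty = let (m , p₀∈A) = A-covers p₀ in
        m , (p₀ , p₀∈A) , λ p∈A → ⊥-elim (empty (_ , p∈A))

      ultrafilter : ∀ n → ∃[ D ] IsUltrafilterOn D × generated (proj₁ (inhabited n)) ⊆ D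
      ultrafilter n = let (m , (a , a∈A) , _) = inhabited n in
        UltrafilterLemma.extend-to-ultrafilter ac (generated-filter a∈A)

      ultrafilter-dense : ∀ n {d} → Upward d → DenseIn d → proj₁ (ultrafilter n) d
      ultrafilter-dense n {d} d↑ dd = let (m , (a , a∈A) , _) = inhabited n in
        proj₂ (proj₂ (ultrafilter n)) (resize (d , d↑ , dd , a , a∈A , proj₂))

      ultrafilter-covers : ∀ p → ∃[ n ] proj₁ (ultrafilter n) (cone p)
      ultrafilter-covers p = let (n , p∈A) = A-covers p ; (m , _ , An⊆Am) = inhabited n in
        n , proj₂ (proj₂ (ultrafilter n))
              (resize (U , _ , (λ q → q , ≲-refl , _) , p , An⊆Am p∈A , proj₁))

      module G = Generic (proj₁ ∘ ultrafilter) (proj₁ ∘ proj₂ ∘ ultrafilter)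
                         ultrafilter-dense ultrafilter-covers

      no-nwd-ultrafilter⇒adds-Cohen-real :
        ¬ (∃[ D ] IsUltrafilter D × ¬ Principal D × IsNowhereDenseFilter D) → AddsCohenReal P
      no-nwd-ultrafilter⇒adds-Cohen-real none =
        G.CohenName.adds-Cohen-real (proj₁ ∘ witness) (λ n {X} → proj₂ (witness n) X)
        where
        witness : ∀ n → ∃[ f ] (∀ X → G.induced n X → ¬ NowhereDense (Image f X))
        -- Without such an `f` the ultrafilter induced by `V n` would be nowhere dense.
        witness n = by-contradiction λ no-f → none
          (G.induced n , G.induced-ultra n , G.induced-nonprincipal n , λ f →
            by-contradiction λ no-X → no-f (f , λ X X∈D nwd → no-X (X , X∈D , nwd)))

theorem2 : (∀ {ℓ} → ExcludedMiddle ℓ) →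
    (∀ {a ℓa b ℓb r} → AxiomOfChoice a ℓa b ℓb r) →
    ∀ {c ℓ₁ ℓ₂} (P : Preorder c ℓ₁ ℓ₂) →
    SigmaCentered P →
    SplitsEverywhere P →
    ¬ AddsCohenReal P →
    ∃[ D ] IsUltrafilter D × ¬ Principal D × IsNowhereDenseFilter D
theorem2 em ac {c} {ℓ₂ = ℓ₂} P (A , A-directed , A-covers) splits no-Cohen = by-contradiction (no-Cohen ∘ adds)
  where
  open Classical em
  adds : ¬ (∃[ D ] IsUltrafilter D × ¬ Principal D × IsNowhereDenseFilter D) → AddsCohenReal P
  adds none with em {P = Preorder.Carrier P}
  ... | yes p =
    Construction.SigmaCenteredUltrafilters.no-nwd-ultrafilter⇒adds-Cohen-real
      P splits ac A A-directed A-covers p none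
  -- Without conditions every sentence is forced vacuously, so any name is Cohen.
  ... | no empty =
    (λ _ _ → Lift (c ⊔ ℓ₂) ⊥) , (λ p → ⊥-elim (empty p)) , λ _ _ _ p → ⊥-elim (empty p)
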